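{- Let $G$ be a finite simple graph with minimum degree $\delta(G)\ge 1$ and let $n\ge 2$ be an integer. Then $\gamma_{tg}(G)=\gamma_{Zg}(G\circ \overline{K}_n)$, where $\overline{K}_n$ is the edgeless graph on $n$ vertices and $\circ$ denotes the lexicographic product.
   Context: Graphs are finite and simple. $N(v)$ and $N[v]=N(v)\cup\{v\}$ denote the open and closed neighborhood of a vertex $v$. The lexicographic product $G\circ H$ has vertex set $V(G)\times V(H)$; vertices $(g_1,h_1)$ and $(g_2,h_2)$ are adjacent if $g_1g_2\in E(G)$, or $g_1=g_2$ and $h_1h_2\in E(H)$. Games: two players, Dominator and Staller, alternately select vertices $v_1,v_2,\ldots$ of an isolate-free graph $G$. In the total domination game the $i$-th move $v_i$ is legal if $N(v_i)\setminus\bigcup_{j=1}^{i-1}N(v_j)\neq\emptyset$. In the Z-domination game the $i$-th move $v_i$ is legal if $N(v_i)\setminus\bigcup_{j=1}^{i-1}N[v_j]\neq\emptyset$. Each game ends when no legal move is available. Dominator wants to minimize the total number of moves, Staller wants to maximize it. When Dominator moves first and both players play optimally, the total number of moves played (by both players) is $\gamma_{tg}(G)$ for the total domination game and $\gamma_{Zg}(G)$ for the Z-domination game. -}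

module Defs where

open import Data.Empty using (⊥)
open import Data.Fin using (Fin)
import Data.Fin.Properties as Fin
open import Data.List using (List; []; _∷_; length; map; filter; allFin)
open import Data.List.Extrema.Nat using (min)
open import Data.List.Membership.Propositional using (lose) renaming (_∈_ to _∈ˡ_)
open import Data.List.Membership.Propositional.Properties using (∈-map⁺; ∈-allFin)
open import Data.List.Relation.Unary.Any using (Any; here; there; any?; satisfied)
open import Data.Nat using (ℕ; suc; _*_; _≤_; _<_; _≥_; z≤n; s≤s)
open import Data.Nat.Induction using (Acc; acc; <-wellFounded)
open import Data.Nat.Properties using (≤-refl; ≤-trans; ≤-antisym; ≤-total; m≤n⇒m≤1+n)
open import Data.Product using (Σ; ∃; _×_; _,_; proj₁; proj₂)
open import Data.Product.Function.NonDependent.Propositional using (_×-↔_)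
open import Data.Sum using (_⊎_; inj₁; inj₂)
open import Function using (flip)
open import Function.Bundles using (_↔_; Inverse)
open import Function.Construct.Identity using (↔-id)
open import Function.Construct.Composition using (_↔-∘_)
open import Function.Construct.Symmetry using (↔-sym)
open import Function.Properties.Inverse using (Inverse⇒Injection)
open import Level using (0ℓ)
open import Relation.Binary using (Rel; Symmetric; Irreflexive; Total; Transitive; Reflexive; DecidableEquality) renaming (Decidable to Decidable₂)
open import Relation.Binary.PropositionalEquality using (_≡_; refl; sym; cong; subst)
open import Relation.Nullary using (¬_; Dec; yes; no; contradiction)
open import Relation.Nullary.Decidable using (map′; ¬?; _×-dec_; _⊎-dec_)
open import Relation.Unary using (Pred; Decidable; _∈_; _⊆_; _∪_; _∖_; ｛_｝; Satisfiable)

record Graph : Set₁ where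
  field
    Vertex : Set
    order  : ℕ
    enum   : Fin order ↔ Vertex
    Adj    : Rel Vertex 0ℓ
    adj?   : Decidable₂ Adj
    symm   : Symmetric Adj
    irrefl : Irreflexive _≡_ Adj

  infix 4 _≟_
  _≟_ : DecidableEquality Vertex
  _≟_ = Fin.inj⇒≟ (Inverse⇒Injection (↔-sym enum))

  vertices : List Vertex
  vertices = map (Inverse.to enum) (allFin order)

  ∈-vertices : ∀ v → v ∈ˡ vertices
  ∈-vertices v = subst (_∈ˡ vertices) (Inverse.strictlyInverseˡ enum v)
    (∈-map⁺ (Inverse.to enum) (∈-allFin (Inverse.from enum v)))

  N : Vertex → Pred Vertex 0ℓ
  N v = Adj v

  N[_] : Vertex → Pred Vertex 0ℓ
  N[ v ] = N v ∪ ｛ v ｝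

  degree : Vertex → ℕ
  degree v = length (filter (adj? v) vertices)

  -- Every degree is less than the order, so the seed of the minimum matters
  -- only for the null graph, whose minimum degree is 0 by this convention.
  δ : ℕ
  δ = min order (map degree vertices)

open Graph using (Vertex)

edgeless : ℕ → Graph
edgeless n = record
  { Vertex = Fin n
  ; order  = n
  ; enum   = ↔-id (Fin n)
  ; Adj    = λ _ _ → ⊥
  ; adj?   = λ _ _ → no λ ()
  ; symm   = λ ()
  ; irrefl = λ _ ()
  }

infixr 7 _⊚_

-- The lexicographic product (∘ is function composition in the library).
_⊚_ : Graph → Graph → Graph
G ⊚ H = record
  { Vertex = G.Vertex × H.Vertex
  ; order  = G.order * H.order
  ; enum   = (G.enum ×-↔ H.enum) ↔-∘ Fin.*↔×
  ; Adj    = λ (g₁ , h₁) (g₂ , h₂) → G.Adj g₁ g₂ ⊎ (g₁ ≡ g₂ × H.Adj h₁ h₂)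
  ; adj?   = λ (g₁ , h₁) (g₂ , h₂) → G.adj? g₁ g₂ ⊎-dec ((g₁ G.≟ g₂) ×-dec H.adj? h₁ h₂)
  ; symm   = λ { (inj₁ a) → inj₁ (G.symm a) ; (inj₂ (e , a)) → inj₂ (sym e , H.symm a) }
  ; irrefl = λ { refl (inj₁ a) → G.irrefl refl a ; refl (inj₂ (_ , a)) → H.irrefl refl a }
  }
  where
  module G = Graph G
  module H = Graph H

data Player : Set where
  dominator staller : Player

private
  module _ {A : Set} {P Q : Pred A 0ℓ} (P? : Decidable P) (Q? : Decidable Q) (P⊆Q : P ⊆ Q) where

    length-filter-≤ : ∀ xs → length (filter P? xs) ≤ length (filter Q? xs)
    length-filter-≤ [] = z≤n
    length-filter-≤ (x ∷ xs) with P? x | Q? x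
    ... | yes _ | yes _  = s≤s (length-filter-≤ xs)
    ... | yes p | no ¬q  = contradiction (P⊆Q p) ¬q
    ... | no _  | yes _  = m≤n⇒m≤1+n (length-filter-≤ xs)
    ... | no _  | no _   = length-filter-≤ xs

    length-filter-< : ∀ {w} → Q w → ¬ P w → ∀ {xs} → w ∈ˡ xs →
                      length (filter P? xs) < length (filter Q? xs)
    length-filter-< q ¬p {x ∷ xs} (here refl) with P? x | Q? x
    ... | yes p | _      = contradiction p ¬p
    ... | no _  | yes _  = s≤s (length-filter-≤ xs)
    ... | no _  | no ¬q  = contradiction q ¬q
    length-filter-< q ¬p {x ∷ xs} (there i) with P? x | Q? x
    ... | yes _ | yes _  = s≤s (length-filter-< q ¬p i)
    ... | yes p | no ¬q  = contradiction (P⊆Q p) ¬q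
    ... | no _  | yes _  = m≤n⇒m≤1+n (length-filter-< q ¬p i)
    ... | no _  | no _   = length-filter-< q ¬p i

-- In the game with covering sets C, playing v covers the vertices in C v, and
-- is allowed when some vertex of the open neighbourhood N v is not covered yet.
-- The history of a position lists the moves played so far, latest first.
module Game (G : Graph) (C : Vertex G → Pred (Vertex G) 0ℓ) where
  open Graph G hiding (Vertex)

  Covered : List (Vertex G) → Pred (Vertex G) 0ℓ
  Covered h w = Any (λ v → w ∈ C v) h

  Legal : List (Vertex G) → Pred (Vertex G) 0ℓ
  Legal h v = Satisfiable (N v ∖ Covered h)

  -- Value p h k: with p to move after the history h, optimal play by both
  -- players lasts exactly k further moves.  The function f gives the values of
  -- the positions reached by the legal moves; at other vertices it is arbitrary.
  data Value : Player → List (Vertex G) → ℕ → Set where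
    over     : ∀ {p h} → (∀ v → ¬ Legal h v) → Value p h 0
    minimise : ∀ {h} (f : Vertex G → ℕ) →
               (∀ u → Legal h u → Value staller (u ∷ h) (f u)) →
               ∀ v → Legal h v → (∀ u → Legal h u → f v ≤ f u) →
               Value dominator h (suc (f v))
    maximise : ∀ {h} (f : Vertex G → ℕ) →
               (∀ u → Legal h u → Value dominator (u ∷ h) (f u)) →
               ∀ v → Legal h v → (∀ u → Legal h u → f v ≥ f u) →
               Value staller h (suc (f v))

  Value-unique : ∀ {p h k l} → Value p h k → Value p h l → k ≡ l
  Value-unique (over _) (over _) = refl
  Value-unique (over n) (minimise _ _ v m _) = contradiction m (n v)
  Value-unique (over n) (maximise _ _ v m _) = contradiction m (n v)
  Value-unique (minimise _ _ v m _) (over n) = contradiction m (n v)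
  Value-unique (maximise _ _ v m _) (over n) = contradiction m (n v)
  Value-unique (minimise f F v m o) (minimise g H w l q) = cong suc (≤-antisym
    (subst (f v ≤_) (Value-unique (F w l) (H w l)) (o w l))
    (subst (g w ≤_) (sym (Value-unique (F v m) (H v m))) (q v m)))
  Value-unique (maximise f F v m o) (maximise g H w l q) = cong suc (≤-antisym
    (subst (_≤ g w) (sym (Value-unique (F v m) (H v m))) (q v m))
    (subst (_≤ f v) (Value-unique (F w l) (H w l)) (o w l)))

  -- A value exists because each move covers a new vertex.
  module Existence (C? : ∀ v → Decidable (C v)) (N⊆C : ∀ v → N v ⊆ C v) where

    private
      covered? : ∀ h → Decidable (Covered h)
      covered? h w = any? (λ v → C? v w) h

      any-vertex? : {P : Pred (Vertex G) 0ℓ} → Decidable P → Dec (∃ P)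
      any-vertex? P? = map′ satisfied (λ (v , pv) → lose (∈-vertices v) pv) (any? P? vertices)

      legal? : ∀ h → Decidable (Legal h)
      legal? h v = any-vertex? (λ w → adj? v w ×-dec ¬? (covered? h w))

      #uncovered : List (Vertex G) → ℕ
      #uncovered h = length (filter (λ w → ¬? (covered? h w)) vertices)

      legal-decreases : ∀ {v} h → Legal h v → #uncovered (v ∷ h) < #uncovered h
      legal-decreases {v} h (w , vw , ¬c) =
        length-filter-< _ _ (λ ¬d d → ¬d (there d)) ¬c (λ ¬d → ¬d (here (N⊆C v vw))) (∈-vertices w)

      module _ {_⊑_ : Rel ℕ 0ℓ} (⊑-refl : Reflexive _⊑_) (⊑-trans : Transitive _⊑_) (⊑-total : Total _⊑_)
               {P : Pred (Vertex G) 0ℓ} (P? : Decidable P) (f : Vertex G → ℕ) where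

        best-in : ∀ v → P v → ∀ xs →
                  ∃ λ b → P b × f b ⊑ f v × (∀ u → u ∈ˡ xs → P u → f b ⊑ f u)
        best-in v pv [] = v , pv , ⊑-refl , λ _ ()
        best-in v pv (x ∷ xs) with best-in v pv xs | P? x
        ... | b , pb , b⊑v , b⊑ | no ¬px =
          b , pb , b⊑v , λ { _ (here refl) px → contradiction px ¬px ; u (there i) pu → b⊑ u i pu }
        ... | b , pb , b⊑v , b⊑ | yes px with ⊑-total (f b) (f x)
        ...   | inj₁ b⊑x = b , pb , b⊑v , λ { _ (here refl) _ → b⊑x ; u (there i) pu → b⊑ u i pu }
        ...   | inj₂ x⊑b = x , px , ⊑-trans x⊑b b⊑v ,
                  λ { _ (here refl) _ → ⊑-refl ; u (there i) pu → ⊑-trans x⊑b (b⊑ u i pu) }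

        best : ∃ P → ∃ λ b → P b × (∀ u → P u → f b ⊑ f u)
        best (v , pv) with best-in v pv vertices
        ... | b , pb , _ , b⊑ = b , pb , λ u → b⊑ u (∈-vertices u)

      choose : ∀ {P : Pred (Vertex G) 0ℓ} {Q : Vertex G → Pred ℕ 0ℓ} → Decidable P →
               (∀ u → P u → ∃ (Q u)) → Σ (Vertex G → ℕ) λ f → ∀ u → P u → Q u (f u)
      choose {P} {Q} P? q = (λ u → proj₁ (pick u)) , (λ u → proj₂ (pick u))
        where
        pick : ∀ u → ∃ λ k → P u → Q u k
        pick u with P? u
        ... | yes pu = proj₁ (q u pu) , λ _ → proj₂ (q u pu)
        ... | no ¬pu = 0 , λ pu → contradiction pu ¬pu

      value-acc : ∀ p h → Acc _<_ (#uncovered h) → ∃ (Value p h)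
      value-acc p h (acc rs) with any-vertex? (legal? h)
      ... | no none = 0 , over (λ v m → none (v , m))
      value-acc dominator h (acc rs) | yes some
        with f , F ← choose (legal? h) (λ u m → value-acc staller (u ∷ h) (rs (legal-decreases h m)))
        with v , m , o ← best {_≤_} ≤-refl ≤-trans ≤-total (legal? h) f some
        = suc (f v) , minimise f F v m o
      value-acc staller h (acc rs) | yes some
        with f , F ← choose (legal? h) (λ u m → value-acc dominator (u ∷ h) (rs (legal-decreases h m)))
        with v , m , o ← best {_≥_} ≤-refl (flip ≤-trans) (flip ≤-total) (legal? h) f some
        = suc (f v) , maximise f F v m o

    value : ∀ p h → ∃ (Value p h)
    value p h = value-acc p h (<-wellFounded _)

-- Both numbers are defined without assuming that G is isolate-free: an
-- isolated vertex is simply never a legal move.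

module TotalGame (G : Graph) where
  open Graph G using (N; adj?)
  open Game G N public
  open Existence adj? (λ _ a → a) public

module ZGame (G : Graph) where
  open Graph G using (N[_]; adj?; _≟_)
  open Game G N[_] public
  open Existence (λ v w → adj? v w ⊎-dec (v ≟ w)) (λ _ → inj₁) public

γtg : Graph → ℕ
γtg G = proj₁ (TotalGame.value G dominator [])

γZg : Graph → ℕ
γZg G = proj₁ (ZGame.value G dominator [])

{-# OPTIONS --safe #-}

-- A move (g , i) of the Z-game covers every fibre over a neighbour of g, so no
-- later move in the fibre over g is legal.  Hence each fibre is played at most
-- once, and as n ≥ 2 it always keeps an unplayed vertex, which is covered only
-- if its projection is covered in the total game.  So a move of the Z-game is
-- legal exactly when its projection is legal in the total game.
module Submission where

open import Defs
open import Data.Fin using (Fin; zero; punchIn)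
open import Data.Fin.Properties using (punchInᵢ≢i)
open import Data.List using (List; []; _∷_; map)
open import Data.List.Membership.Propositional using (_∉_; find; lose)
open import Data.List.Membership.Propositional.Properties using (∈-map⁺)
import Data.List.Relation.Unary.Any as Any
open Any using (here; there)
open import Data.List.Relation.Unary.Any.Properties using (map⁻)
open import Data.Nat using (ℕ; suc; _≤_; s≤s)
open import Data.Product using (∃; _×_; _,_; proj₁; proj₂)
open import Data.Product.Properties using (,-injectiveʳ)
open import Data.Sum using (inj₁; inj₂)
open import Function using (_∘_)
open import Relation.Binary.PropositionalEquality using (_≡_; refl)
open import Relation.Nullary using (yes; no; contradiction)

module _ (G : Graph) (m : ℕ) where
  open Graph G

  private
    module T = TotalGame G
    module Z = ZGame (G ⊚ edgeless (suc (suc m)))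

    Move : Set
    Move = Vertex × Fin (suc (suc m))

  FibresOpen : List Move → Set
  FibresOpen H = ∀ w → ∃ λ i → (w , i) ∉ H

  covered-lift : ∀ {H w i} → T.Covered (map proj₁ H) w → Z.Covered H (w , i)
  covered-lift = Any.map (inj₁ ∘ inj₁) ∘ map⁻

  -- Closed neighbourhoods differ from open ones only by the played vertex itself, so an unplayed
  -- vertex is covered through an edge of `G`.
  covered-project : ∀ {H w i} → (w , i) ∉ H → Z.Covered H (w , i) → T.Covered (map proj₁ H) w
  covered-project ∉H c with find c
  ... | _ , v∈H , inj₁ (inj₁ a)        = lose (∈-map⁺ proj₁ v∈H) a
  ... | _ , v∈H , inj₁ (inj₂ (_ , ()))
  ... | _ , v∈H , inj₂ refl            = contradiction v∈H ∉H

  legal-project : ∀ H v → Z.Legal H v → T.Legal (map proj₁ H) (proj₁ v)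
  legal-project _ _ ((w , _) , inj₁ a , ¬c)        = w , a , ¬c ∘ covered-lift
  legal-project _ _ (_       , inj₂ (_ , ()) , _)

  legal-lift : ∀ {H} g i → FibresOpen H → T.Legal (map proj₁ H) g → Z.Legal H (g , i)
  -- A played copy of `w` covers itself, so the witness is taken at an unplayed index `j`.
  legal-lift _ _ open-H (w , a , ¬c) with j , ∉H ← open-H w =
    (w , j) , inj₁ a , ¬c ∘ covered-project ∉H

  -- Vertices of one fibre share their open neighbourhood, so an earlier move `(g , j)` would have
  -- covered the witness of legality.
  legal⇒fibre-unplayed : ∀ H g {i j} → Z.Legal H (g , i) → (g , j) ∉ H
  legal⇒fibre-unplayed _ _ (_ , inj₁ a , ¬c)        ∈H = ¬c (lose ∈H (inj₁ (inj₁ a)))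
  legal⇒fibre-unplayed _ _ (_ , inj₂ (_ , ()) , _)

  fibresOpen-step : ∀ H v → FibresOpen H → Z.Legal H v → FibresOpen (v ∷ H)
  fibresOpen-step H (g , i) open-H l w with g ≟ w
  -- An index other than `i`, available because the fibre has at least two vertices.
  ... | yes refl = punchIn i zero , λ where
    (here e)   → punchInᵢ≢i i zero (,-injectiveʳ e)
    (there ∈H) → legal⇒fibre-unplayed H g {i} l ∈H
  ... | no g≢w with j , ∉H ← open-H w = j , λ where
    (here refl) → g≢w refl
    (there ∈H)  → ∉H ∈H

  -- Induction on the total-game value: the value after a move depends only on its projection, so
  -- `f ∘ proj₁` serves for the Z-game and any copy of an optimal `v` is optimal.
  value-lift : ∀ {p} H {k} → FibresOpen H → T.Value p (map proj₁ H) k → Z.Value p H k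
  value-lift H open-H (T.over none) = Z.over λ v → none (proj₁ v) ∘ legal-project H v
  value-lift H open-H (T.minimise f F v l o) = Z.minimise (f ∘ proj₁)
    (λ u l′ → value-lift (u ∷ H) (fibresOpen-step H u open-H l′) (F (proj₁ u) (legal-project H u l′)))
    (v , zero) (legal-lift v zero open-H l) (λ u → o (proj₁ u) ∘ legal-project H u)
  value-lift H open-H (T.maximise f F v l o) = Z.maximise (f ∘ proj₁)
    (λ u l′ → value-lift (u ∷ H) (fibresOpen-step H u open-H l′) (F (proj₁ u) (legal-project H u l′)))
    (v , zero) (legal-lift v zero open-H l) (λ u → o (proj₁ u) ∘ legal-project H u)

theorem3p1 : (G : Graph) → 1 ≤ Graph.δ G → (n : ℕ) → 2 ≤ n → γtg G ≡ γZg (G ⊚ edgeless n)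
theorem3p1 G _ (suc (suc m)) (s≤s (s≤s _)) = Z.Value-unique
  -- Before the first move every index is unplayed.
  (value-lift G m [] (λ _ → zero , λ ()) (proj₂ (TotalGame.value G dominator [])))
  (proj₂ (Z.value dominator []))
  where module Z = ZGame (G ⊚ edgeless (suc (suc m)))
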